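{- There is a constant $C>0$ such that every disk graph $G$ on $n\geq 2$ vertices satisfies $\chi_s(G)\leq C\log^3 n$; i.e. $\chi_s(G)=O(\log^3 n)$.
   Context: A disk graph is the intersection graph of a finite family of closed disks in the plane. A subcoloring of a graph $G$ is a partition of $V(G)$ into color classes each inducing a disjoint union of cliques (no induced path on three vertices); $\chi_s(G)$, the subchromatic number, is the minimum number of colors of a subcoloring.
   Formalization: The disks are taken with rational centres and positive rational radii instead of real ones; every finite disk graph has such a representation by slightly enlarging the radii and perturbing. -}

module Defs where

open import Data.Nat using (ℕ)
open import Data.Fin using (Fin)
open import Data.Product using (Σ; _×_)
open import Relation.Binary.PropositionalEquality using (_≡_; _≢_)
open import Relation.Nullary using (¬_)
open import Function.Bundles using (_⇔_)
open import Data.Rational as ℚ using (ℚ; 0ℚ)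

record Graph (n : ℕ) : Set₁ where
  field
    Adj     : Fin n → Fin n → Set
    sym     : ∀ {u v} → Adj u v → Adj v u
    irrefl  : ∀ {u} → ¬ Adj u u
open Graph public

-- A closed disk in the plane: centre (x , y) and positive radius r.
-- (Rational data suffice: every finite disk graph is realisable with
-- rational centres and radii.)
record Disk : Set where
  constructor disk
  field
    x y r : ℚ
    r>0   : 0ℚ ℚ.< r
open Disk public

-- Two closed disks intersect iff the distance of centres ≤ sum of radii
-- (compared via squares, both sides being nonnegative).
Intersect : Disk → Disk → Set
Intersect D E =
  (x D ℚ.- x E) ℚ.* (x D ℚ.- x E) ℚ.+ (y D ℚ.- y E) ℚ.* (y D ℚ.- y E)
    ℚ.≤ (r D ℚ.+ r E) ℚ.* (r D ℚ.+ r E)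

IsDiskGraph : ∀ {n} → Graph n → Set
IsDiskGraph {n} G =
  Σ (Fin n → Disk) λ D → ∀ u v → Adj G u v ⇔ (u ≢ v × Intersect (D u) (D v))

-- c : Fin n → Fin k is a subcoloring: every colour class induces a
-- disjoint union of cliques, i.e. contains no induced P₃.
IsSubcoloring : ∀ {n k} → Graph n → (Fin n → Fin k) → Set
IsSubcoloring G c =
  ∀ u v w → c u ≡ c v → c v ≡ c w → u ≢ w →
    Adj G u v → Adj G v w → Adj G u w

SubchromaticAtMost : ∀ {n} → Graph n → ℕ → Set
SubchromaticAtMost {n} G k = Σ (Fin n → Fin k) λ c → IsSubcoloring G c

{-# OPTIONS --safe #-}

-- Every disk v gets a dyadic level and a stabbing point for its interval [x − r, x + r], such that
-- overlapping intervals of equal level have the same stabbing point s; likewise t for [y − r, y + r].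
-- Hence adjacent disks of equal levels meet both axes of a common coordinate system centred at (s , t).
-- For disks meeting both axes, let p = a² + b² − r² be the power of the origin.  If two of them
-- intersect then p ≤ 7 r r′ and p′ ≤ 7 r r′, so the intervals [p / 7r, r] overlap, and a third level
-- yields a common stabbing point τ, with p ≤ 7 r τ and τ ≤ r.  Among the disks sharing s, t and τ, those
-- with r ≥ 7τ and centre in a fixed quadrant form a clique, and the others have their centre in
-- [−7τ, 7τ]², where all the disks centred in a fixed τ × τ cell form a clique.  So three levels and
-- O(1) further colours suffice.

module Submission where

open import Defs
open import Data.Nat using (ℕ; zero; suc)
open import Data.Fin using (Fin; zero; suc; combine; inject≤)
import Data.Fin.Properties as Fin
import Data.Integer as ℤ
open import Data.Rational as ℚ using (ℚ)
import Data.Rational.Properties as ℚ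
open import Data.Product using (Σ; _×_; _,_; proj₁; proj₂)
open import Data.Sum using (_⊎_; inj₁; inj₂)
open import Data.List using ([]; _∷_; length; filter; allFin; map)
open import Data.List.Properties using (filter-notAll; length-tabulate)
open import Data.List.Membership.Propositional using (_∈_; lose)
open import Data.List.Membership.Propositional.Properties using (∈-allFin; ∈-filter⁺; ∈-map⁺)
open import Data.List.Relation.Unary.Any using (here; there)
import Data.List.Relation.Unary.All as All
import Data.List.Relation.Unary.All.Properties as All
open import Relation.Binary.Bundles using (DecTotalOrder)
open import Data.List.Extrema (DecTotalOrder.totalOrder ℚ.≤-decTotalOrder) using (min; max; min≤v⁺; v≤min⁺; v≤max⁺)
open import Function using (_∘_)
open import Function.Bundles using (Equivalence)
open import Level using (0ℓ)
open import Relation.Binary.PropositionalEquality renaming (sym to ≡-sym)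
open import Relation.Nullary using (¬_; Dec; yes; no; contradiction)
open import Relation.Unary using (Pred; Decidable; _⊆_)

-- Bits and codes

bit : ∀ {P : Set} → Dec P → Fin 2
bit (yes _) = zero
bit (no  _) = suc zero

bit-injective : ∀ {P Q : Set} (P? : Dec P) (Q? : Dec Q) → bit P? ≡ bit Q? → (P × Q) ⊎ (¬ P × ¬ Q)
bit-injective (yes p) (yes q) _ = inj₁ (p , q)
bit-injective (no ¬p) (no ¬q) _ = inj₂ (¬p , ¬q)

-- The bits record whether r ≥ 7τ and the signs of the centre's coordinates; the last two entries
-- are its column and row in a 14 × 14 grid. Large disks are compared by signs, small ones by cells.
Code : Set
Code = Fin 2 × Fin 2 × Fin 2 × Fin 14 × Fin 14

-- Plane geometry of disks over the rationals

module DiskGeometry where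

  open import Data.Rational using (0ℚ; 1ℚ; _+_; _*_; _-_; -_; _≤_; _/_; 1/_; Positive; NonZero; positive; nonNegative)
  open import Data.Rational.Properties
  open import Data.Rational.Solver
  open +-*-Solver

  -- Polynomial inequalities are certified by writing the difference as a sum of products of
  -- nonnegative terms; the ring solver checks the identity.
  ≤-by : ∀ {p q d} → 0ℚ ≤ d → q ≡ p + d → p ≤ q
  ≤-by {p} {q} {d} 0≤d eq = subst₂ _≤_ (+-identityʳ p) (≡-sym eq) (+-monoʳ-≤ p 0≤d)

  infixl 6 _⊕_
  infixl 7 _⊛_

  _⊕_ : ∀ {p q} → 0ℚ ≤ p → 0ℚ ≤ q → 0ℚ ≤ p + q
  _⊕_ = +-mono-≤

  _⊛_ : ∀ {p q} → 0ℚ ≤ p → 0ℚ ≤ q → 0ℚ ≤ p * q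
  _⊛_ {p} {q} 0≤p 0≤q = subst (_≤ p * q) (*-zeroʳ p) (*-monoˡ-≤-nonNeg p {{nonNegative 0≤p}} 0≤q)

  diff≥0 : ∀ {p q} → p ≤ q → 0ℚ ≤ q - p
  diff≥0 {p} {q} p≤q = subst (_≤ q - p) (+-inverseʳ p) (+-monoˡ-≤ (- p) p≤q)

  neg*neg≥0 : ∀ {p q} → p ≤ 0ℚ → q ≤ 0ℚ → 0ℚ ≤ p * q
  neg*neg≥0 {p} {q} p≤0 q≤0 = subst (0ℚ ≤_)
    (solve 2 (λ p q → (con 0ℚ :- p) :* (con 0ℚ :- q) := p :* q) refl p q)
    (diff≥0 p≤0 ⊛ diff≥0 q≤0)

  square≥0 : ∀ p → 0ℚ ≤ p * p
  square≥0 p with ≤-total 0ℚ p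
  ... | inj₁ 0≤p = 0≤p ⊛ 0≤p
  ... | inj₂ p≤0 = neg*neg≥0 p≤0 p≤0

  square-mono : ∀ {p q} → - q ≤ p → p ≤ q → p * p ≤ q * q
  square-mono {p} {q} -q≤p p≤q = ≤-by (diff≥0 -q≤p ⊛ diff≥0 p≤q)
    (solve 2 (λ p q → q :* q := p :* p :+ (p :- :- q) :* (q :- p)) refl p q)

  square-cancel-≤ : ∀ {p q} → 0ℚ ≤ q → p * p ≤ q * q → p ≤ q
  square-cancel-≤ {p} {q} 0≤q pp≤qq = ≮⇒≥ λ q<p → <-irrefl refl (begin-strict
    q * q  ≤⟨ *-monoˡ-≤-nonNeg q {{nonNegative 0≤q}} (<⇒≤ q<p) ⟩
    q * p  <⟨ *-monoˡ-<-pos p {{positive (≤-<-trans 0≤q q<p)}} q<p ⟩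
    p * p  ≤⟨ pp≤qq ⟩
    q * q  ∎)
    where open ≤-Reasoning

  r≥0 : ∀ D → 0ℚ ≤ r D
  r≥0 D = <⇒≤ (r>0 D)

  Intersect-sym : ∀ D E → Intersect D E → Intersect E D
  Intersect-sym D E = subst₂ _≤_
    (solve 4 (λ a b a′ b′ → (a :- a′) :* (a :- a′) :+ (b :- b′) :* (b :- b′)
                         := (a′ :- a) :* (a′ :- a) :+ (b′ :- b) :* (b′ :- b)) refl (x D) (y D) (x E) (y E))
    (cong (λ s → s * s) (+-comm (r D) (r E)))

  -- Dropping the square of the other coordinate leaves (x - x′)² ≤ (r + r′)².
  intersect⇒x-overlap : ∀ D E → Intersect D E → x D - r D ≤ x E + r E
  intersect⇒x-overlap D E h = ≤-by (diff≥0 (square-cancel-≤ (r≥0 D ⊕ r≥0 E)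
      (≤-trans (≤-by (square≥0 (y D - y E)) refl) h)))
    (solve 4 (λ a r a′ r′ → a′ :+ r′ := (a :- r) :+ (r :+ r′ :- (a :- a′))) refl (x D) (r D) (x E) (r E))

  intersect⇒y-overlap : ∀ D E → Intersect D E → y D - r D ≤ y E + r E
  intersect⇒y-overlap D E h = ≤-by (diff≥0 (square-cancel-≤ (r≥0 D ⊕ r≥0 E)
      (≤-trans (≤-by (square≥0 (x D - x E)) (+-comm ((x D - x E) * (x D - x E)) ((y D - y E) * (y D - y E)))) h)))
    (solve 4 (λ a r a′ r′ → a′ :+ r′ := (a :- r) :+ (r :+ r′ :- (a :- a′))) refl (y D) (r D) (y E) (r E))

  shift : ℚ → ℚ → Disk → Disk
  shift s t D = disk (x D - s) (y D - t) (r D) (r>0 D)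

  shift-distance : ∀ s t D E → (x D - x E) * (x D - x E) + (y D - y E) * (y D - y E) ≡
    (x (shift s t D) - x (shift s t E)) * (x (shift s t D) - x (shift s t E)) +
    (y (shift s t D) - y (shift s t E)) * (y (shift s t D) - y (shift s t E))
  shift-distance s t D E = cong₂ (λ a b → a * a + b * b) (eq (x D) (x E) s) (eq (y D) (y E) t)
    where
    eq : ∀ p q s → p - q ≡ (p - s) - (q - s)
    eq = solve 3 (λ p q s → p :- q := (p :- s) :- (q :- s)) refl

  shift-intersect⁺ : ∀ s t D E → Intersect D E → Intersect (shift s t D) (shift s t E)
  shift-intersect⁺ s t D E = subst (_≤ (r D + r E) * (r D + r E)) (shift-distance s t D E)

  shift-intersect⁻ : ∀ s t D E → Intersect (shift s t D) (shift s t E) → Intersect D E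
  shift-intersect⁻ s t D E = subst (_≤ (r D + r E) * (r D + r E)) (≡-sym (shift-distance s t D E))

  -- Power of the origin and gaps

  record MeetsAxes (D : Disk) : Set where
    field
      -r≤x : - r D ≤ x D
      x≤r  : x D ≤ r D
      -r≤y : - r D ≤ y D
      y≤r  : y D ≤ r D
  open MeetsAxes

  power : Disk → ℚ
  power D = x D * x D + y D * y D - r D * r D

  -- 7 = 2 + 2 + 2 + 1: for intersecting disks p′ ≤ 2rr′ + 2aa′ + 2bb′ + r², where aa′ and bb′ are
  -- at most rr′, and so is r² when r ≤ r′.
  seven : ℚ
  seven = ℤ.+ 7 / 1

  power≤r² : ∀ {D} → MeetsAxes D → power D ≤ r D * r D
  power≤r² {D} m = ≤-by (diff≥0 (square-mono (-r≤x m) (x≤r m)) ⊕ diff≥0 (square-mono (-r≤y m) (y≤r m)))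
    (solve 3 (λ a b r → r :* r := a :* a :+ b :* b :- r :* r :+ ((r :* r :- a :* a) :+ (r :* r :- b :* b)))
      refl (x D) (y D) (r D))

  r²≤7rr′ : ∀ {D E} → r D ≤ r E → r D * r D ≤ seven * r D * r E
  r²≤7rr′ {D} {E} r≤r′ = ≤-by (r≥0 D ⊛ diff≥0 r≤r′ ⊕ 6≥0 ⊛ (r≥0 D ⊛ r≥0 E))
    (solve 2 (λ r r′ → con seven :* r :* r′ := r :* r :+ (r :* (r′ :- r) :+ con (ℤ.+ 6 / 1) :* (r :* r′))) refl (r D) (r E))
    where
    6≥0 : 0ℚ ≤ ℤ.+ 6 / 1
    6≥0 = nonNegative⁻¹ (ℤ.+ 6 / 1)

  -- If E is the smaller disk this is a² + b² ≤ 2r²; otherwise expand (a − a′)² + (b − b′)² ≤ (r + r′)².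
  intersect⇒power≤ : ∀ D E → MeetsAxes D → MeetsAxes E → Intersect D E → power E ≤ seven * r E * r D
  intersect⇒power≤ D E m m′ h with ≤-total (r E) (r D)
  ... | inj₁ r′≤r = ≤-trans (power≤r² m′) (r²≤7rr′ {E} {D} r′≤r)
  ... | inj₂ r≤r′ = ≤-by
    ( diff≥0 h
    -- The two products sum to 2rr′ - 2aa′ whatever the signs of a and a′; the next line does the
    -- same for b and b′.
    ⊕ (diff≥0 (x≤r m) ⊛ diff≥0 (-r≤x m′) ⊕ diff≥0 (-r≤x m) ⊛ diff≥0 (x≤r m′))
    ⊕ (diff≥0 (y≤r m) ⊛ diff≥0 (-r≤y m′) ⊕ diff≥0 (-r≤y m) ⊛ diff≥0 (y≤r m′))
    ⊕ (square≥0 (x D) ⊕ square≥0 (y D))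
    ⊕ diff≥0 r≤r′ ⊛ r≥0 D)
    (solve 6 (λ a b r a′ b′ r′ →
        con seven :* r′ :* r :=
        a′ :* a′ :+ b′ :* b′ :- r′ :* r′ :+
        ( ((r :+ r′) :* (r :+ r′) :- ((a :- a′) :* (a :- a′) :+ (b :- b′) :* (b :- b′)))
        :+ ((r :- a) :* (a′ :- :- r′) :+ (a :- :- r) :* (r′ :- a′))
        :+ ((r :- b) :* (b′ :- :- r′) :+ (b :- :- r) :* (r′ :- b′))
        :+ (a :* a :+ b :* b)
        :+ (r′ :- r) :* r))
      refl (x D) (y D) (r D) (x E) (y E) (r E))

  7r>0 : ∀ D → Positive (seven * r D)
  7r>0 D = pos*pos⇒pos seven (r D) {{positive (r>0 D)}}

  -- Chosen so that the bound on `power E` for intersecting disks reads `gap E ≤ r D`; by symmetry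
  -- the intervals from `gap` to `r` overlap.
  gap : Disk → ℚ
  gap D = power D * (1/ (seven * r D)) {{pos⇒nonZero (seven * r D) {{7r>0 D}}}}

  gap-cancel : ∀ D → gap D * (seven * r D) ≡ power D
  gap-cancel D = begin
    power D * 1/ s * s    ≡⟨ *-assoc (power D) (1/ s) s ⟩
    power D * (1/ s * s)  ≡⟨ cong (power D *_) (*-inverseˡ s) ⟩
    power D * 1ℚ          ≡⟨ *-identityʳ (power D) ⟩
    power D               ∎
    where
    open ≡-Reasoning
    s = seven * r D
    instance
      s≢0 : NonZero s
      s≢0 = pos⇒nonZero s {{7r>0 D}}

  gap≤⁺ : ∀ D {t} → power D ≤ seven * r D * t → gap D ≤ t
  gap≤⁺ D {t} h = *-cancelʳ-≤-pos (seven * r D) {{7r>0 D}}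
    (subst₂ _≤_ (≡-sym (gap-cancel D)) (*-comm (seven * r D) t) h)

  gap≤⁻ : ∀ D {t} → gap D ≤ t → power D ≤ seven * r D * t
  gap≤⁻ D {t} h = subst₂ _≤_ (gap-cancel D) (*-comm t (seven * r D))
    (*-monoʳ-≤-nonNeg (seven * r D) {{pos⇒nonNeg (seven * r D) {{7r>0 D}}}} h)

  gap≤r : ∀ {D} → MeetsAxes D → gap D ≤ r D
  gap≤r {D} m = gap≤⁺ D (≤-trans (power≤r² m) (r²≤7rr′ {D} {D} ≤-refl))

  -- Cells on a line

  cell : ∀ m → ℚ → ℚ → Fin (suc m)
  cell zero    δ a = zero
  cell (suc m) δ a with a ≤? δ
  ... | yes _ = zero
  ... | no  _ = suc (cell m δ (a - δ))

  extent : ℕ → ℚ → ℚ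
  extent zero    δ = δ
  extent (suc m) δ = extent m δ + δ

  -- The outermost cells are unbounded: 0 ≤ a′ cuts off the first and the bound on a the last, which
  -- is enough for a one-sided estimate.
  cell-close : ∀ m {δ a a′} → 0ℚ ≤ a′ → a ≤ extent m δ →
    cell m δ a ≡ cell m δ a′ → a - a′ ≤ δ
  cell-close zero {δ} {a} {a′} 0≤a′ a≤δ eq = ≤-by (diff≥0 a≤δ ⊕ 0≤a′)
    (solve 3 (λ δ a a′ → δ := a :- a′ :+ (δ :- a :+ a′)) refl δ a a′)
  cell-close (suc m) {δ} {a} {a′} 0≤a′ a≤ eq with a ≤? δ | a′ ≤? δ
  ... | yes a≤δ | yes _   = cell-close 0 0≤a′ a≤δ refl
  ... | no _    | no a′≰δ = subst (_≤ δ)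
    (solve 3 (λ δ a a′ → (a :- δ) :- (a′ :- δ) := a :- a′) refl δ a a′)
    (cell-close m (diff≥0 (<⇒≤ (≰⇒> a′≰δ)))
      (≤-by (diff≥0 a≤) (solve 3 (λ e δ a → e := a :- δ :+ (e :+ δ :- a)) refl (extent m δ) δ a))
      (Fin.suc-injective eq))

  -- Adding 7τ moves [-7τ, 7τ] to [0, 14τ], which 14 cells of width τ cover; 13 is the index of the
  -- last one.
  gridCell : ℚ → ℚ → Fin 14
  gridCell τ a = cell 13 τ (a + seven * τ)

  gridCell-close : ∀ {τ a a′} → - (seven * τ) ≤ a → a ≤ seven * τ → - (seven * τ) ≤ a′ → a′ ≤ seven * τ →
    gridCell τ a ≡ gridCell τ a′ → (a - a′) * (a - a′) ≤ τ * τ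
  gridCell-close {τ} {a} {a′} l u l′ u′ eq = square-mono
      (≤-by (diff≥0 (half l u′ (≡-sym eq))) (solve 3 (λ τ a a′ → a :- a′ := :- τ :+ (τ :- (a′ :- a))) refl τ a a′))
      (half l′ u eq)
    where
    half : ∀ {a a′} → - (seven * τ) ≤ a′ → a ≤ seven * τ → gridCell τ a ≡ gridCell τ a′ → a - a′ ≤ τ
    half {a} {a′} l′ u eq = subst (_≤ τ)
      (solve 3 (λ s a a′ → (a :+ s) :- (a′ :+ s) := a :- a′) refl (seven * τ) a a′)
      (cell-close 13
        (subst (0ℚ ≤_) (solve 2 (λ s a → a :- :- s := a :+ s) refl (seven * τ) a′) (diff≥0 l′))
        (≤-by (diff≥0 u) (solve 2 (λ τ a →
           τ :+ τ :+ τ :+ τ :+ τ :+ τ :+ τ :+ τ :+ τ :+ τ :+ τ :+ τ :+ τ :+ τ :=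
           a :+ con seven :* τ :+ (con seven :* τ :- a)) refl τ a))
        eq)

  bit-sign : ∀ {a a′} → bit (0ℚ ≤? a) ≡ bit (0ℚ ≤? a′) → 0ℚ ≤ a * a′
  bit-sign {a} {a′} eq with bit-injective (0ℚ ≤? a) (0ℚ ≤? a′) eq
  ... | inj₁ (h , h′) = h ⊛ h′
  ... | inj₂ (h , h′) = neg*neg≥0 (<⇒≤ (≰⇒> h)) (<⇒≤ (≰⇒> h′))

  -- Disks with common stabbing points

  record Anchored (τ : ℚ) (D : Disk) : Set where
    field
      meetsAxes : MeetsAxes D
      gap≤τ     : gap D ≤ τ
      τ≤r       : τ ≤ r D
  open Anchored

  -- Intersection means p + p′ ≤ 2rr′ + 2aa′ + 2bb′. Here p ≤ 7rτ ≤ rr′ because 7τ ≤ r′, likewise p′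
  -- ≤ rr′, and aa′ and bb′ are nonnegative.
  intersect-large : ∀ {τ D E} → Anchored τ D → Anchored τ E → seven * τ ≤ r D → seven * τ ≤ r E →
    0ℚ ≤ x D * x E → 0ℚ ≤ y D * y E → Intersect D E
  intersect-large {τ} {D} {E} A B l l′ xx yy = ≤-by
    ( diff≥0 (gap≤⁻ D (gap≤τ A)) ⊕ diff≥0 (gap≤⁻ E (gap≤τ B))
    ⊕ r≥0 D ⊛ diff≥0 l′ ⊕ r≥0 E ⊛ diff≥0 l ⊕ (xx ⊕ xx) ⊕ (yy ⊕ yy))
    (solve 7 (λ τ a b r a′ b′ r′ →
        (r :+ r′) :* (r :+ r′) :=
        (a :- a′) :* (a :- a′) :+ (b :- b′) :* (b :- b′) :+
        ( (con seven :* r :* τ :- (a :* a :+ b :* b :- r :* r))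
        :+ (con seven :* r′ :* τ :- (a′ :* a′ :+ b′ :* b′ :- r′ :* r′))
        :+ r :* (r′ :- con seven :* τ) :+ r′ :* (r :- con seven :* τ)
        :+ (a :* a′ :+ a :* a′) :+ (b :* b′ :+ b :* b′)))
      refl τ (x D) (y D) (r D) (x E) (y E) (r E))

  -- Since |a|, |b| ≤ r ≤ 7τ, both centres lie in the grid; in a common cell their squared distance
  -- is at most 2τ² ≤ (2τ)² ≤ (r + r′)².
  intersect-small : ∀ {τ D E} → Anchored τ D → Anchored τ E → r D ≤ seven * τ → r E ≤ seven * τ →
    gridCell τ (x D) ≡ gridCell τ (x E) → gridCell τ (y D) ≡ gridCell τ (y E) → Intersect D E
  intersect-small {τ} {D} {E} A B l l′ xx yy = begin
    (x D - x E) * (x D - x E) + (y D - y E) * (y D - y E)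
      ≤⟨ +-mono-≤ (close x (-r≤x (meetsAxes A)) (x≤r (meetsAxes A)) (-r≤x (meetsAxes B)) (x≤r (meetsAxes B)) xx)
                  (close y (-r≤y (meetsAxes A)) (y≤r (meetsAxes A)) (-r≤y (meetsAxes B)) (y≤r (meetsAxes B)) yy) ⟩
    τ * τ + τ * τ
      ≤⟨ ≤-by (square≥0 τ ⊕ square≥0 τ) (solve 1 (λ τ → (τ :+ τ) :* (τ :+ τ) := τ :* τ :+ τ :* τ :+ (τ :* τ :+ τ :* τ)) refl τ) ⟩
    (τ + τ) * (τ + τ)
      ≤⟨ square-mono -[r+r′]≤τ+τ (+-mono-≤ (τ≤r A) (τ≤r B)) ⟩
    (r D + r E) * (r D + r E) ∎
    where
    open ≤-Reasoning
    -- `Anchored` alone allows negative τ; 0 ≤ r ≤ 7τ excludes it.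
    0≤τ : 0ℚ ≤ τ
    0≤τ = *-cancelˡ-≤-pos seven (subst (_≤ seven * τ) (≡-sym (*-zeroʳ seven)) (≤-trans (r≥0 D) l))
    -[r+r′]≤τ+τ : - (r D + r E) ≤ τ + τ
    -[r+r′]≤τ+τ = ≤-trans (neg-antimono-≤ (r≥0 D ⊕ r≥0 E)) (0≤τ ⊕ 0≤τ)
    close : (c : Disk → ℚ) → - r D ≤ c D → c D ≤ r D → - r E ≤ c E → c E ≤ r E →
      gridCell τ (c D) ≡ gridCell τ (c E) → (c D - c E) * (c D - c E) ≤ τ * τ
    close c p q p′ q′ = gridCell-close (≤-trans (neg-antimono-≤ l) p) (≤-trans q l)
      (≤-trans (neg-antimono-≤ l′) p′) (≤-trans q′ l′)

  code : ℚ → Disk → Code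
  code τ D = bit (seven * τ ≤? r D) , bit (0ℚ ≤? x D) , bit (0ℚ ≤? y D) , gridCell τ (x D) , gridCell τ (y D)

  anchored⇒intersect : ∀ {τ D E} → Anchored τ D → Anchored τ E → code τ D ≡ code τ E → Intersect D E
  anchored⇒intersect {τ} {D} {E} A B eq
    with bit-injective (seven * τ ≤? r D) (seven * τ ≤? r E) (cong proj₁ eq)
  ... | inj₁ (l , l′) = intersect-large A B l l′
    (bit-sign (cong (proj₁ ∘ proj₂) eq)) (bit-sign (cong (proj₁ ∘ proj₂ ∘ proj₂) eq))
  ... | inj₂ (l , l′) = intersect-small A B (<⇒≤ (≰⇒> l)) (<⇒≤ (≰⇒> l′))
    (cong (proj₁ ∘ proj₂ ∘ proj₂ ∘ proj₂) eq) (cong (proj₂ ∘ proj₂ ∘ proj₂ ∘ proj₂) eq)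

  meetsAxes-shift : ∀ {s t} D → x D - r D ≤ s → s ≤ x D + r D → y D - r D ≤ t → t ≤ y D + r D →
    MeetsAxes (shift s t D)
  meetsAxes-shift {s} {t} D l u l′ u′ = record
    { -r≤x = lower (x D) u ; x≤r = upper (x D) l ; -r≤y = lower (y D) u′ ; y≤r = upper (y D) l′ }
    where
    lower : ∀ a {s} → s ≤ a + r D → - r D ≤ a - s
    lower a {s} h = ≤-by (diff≥0 h) (solve 3 (λ a r s → a :- s := :- r :+ (a :+ r :- s)) refl a (r D) s)
    upper : ∀ a {s} → a - r D ≤ s → a - s ≤ r D
    upper a {s} h = ≤-by (diff≥0 h) (solve 3 (λ a r s → r := a :- s :+ (s :- (a :- r))) refl a (r D) s)

  -- The two translations have separate variables, so that equations between stabbing points can be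
  -- matched with `refl`.
  shift-gap≤r : ∀ {s t s′ t′} D E → s ≡ s′ → t ≡ t′ → MeetsAxes (shift s t D) → MeetsAxes (shift s′ t′ E) →
    Intersect D E → gap (shift s′ t′ E) ≤ r D
  shift-gap≤r {s} {t} D E refl refl m m′ h = gap≤⁺ (shift s t E)
    (intersect⇒power≤ (shift s t D) (shift s t E) m m′ (shift-intersect⁺ s t D E h))

  shift-anchored⇒intersect : ∀ {s t τ s′ t′ τ′} D E → s ≡ s′ → t ≡ t′ → τ ≡ τ′ →
    Anchored τ (shift s t D) → Anchored τ′ (shift s′ t′ E) →
    code τ (shift s t D) ≡ code τ′ (shift s′ t′ E) → Intersect D E
  shift-anchored⇒intersect {s} {t} D E refl refl refl A B eq =
    shift-intersect⁻ s t D E (anchored⇒intersect A B eq)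

-- Dyadic levels of integer intervals

open import Data.Nat using (_≤_; _<_; _+_; _*_; _^_; _≤?_; z≤n; s≤s; s≤s⁻¹; ⌊_/2⌋; ⌈_/2⌉)
open import Data.Nat.Properties
open import Data.Nat.Logarithm using (⌊log₂_⌋; ⌊log₂⌋-mono-≤; ⌊log₂⌊n/2⌋⌋≡⌊log₂n⌋∸1)
open import Data.Nat.Solver using (module +-*-Solver)

-- For a ≤ b, the largest k ≤ d such that 2^k divides some integer in [a, b]: the interval
-- [⌈a/2⌉, ⌊b/2⌋] consists of the halves of the even integers in [a, b].
dyadicLevel : (d a b : ℕ) → Fin (suc d)
dyadicLevel zero    a b = zero
dyadicLevel (suc d) a b with ⌈ a /2⌉ ≤? ⌊ b /2⌋
... | yes _ = suc (dyadicLevel d ⌈ a /2⌉ ⌊ b /2⌋)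
... | no  _ = zero

dyadicPoint : (d a b : ℕ) → ℕ
dyadicPoint zero    a b = a
dyadicPoint (suc d) a b with ⌈ a /2⌉ ≤? ⌊ b /2⌋
... | yes _ = dyadicPoint d ⌈ a /2⌉ ⌊ b /2⌋ + dyadicPoint d ⌈ a /2⌉ ⌊ b /2⌋
... | no  _ = a

n≤⌈n/2⌉+⌈n/2⌉ : ∀ n → n ≤ ⌈ n /2⌉ + ⌈ n /2⌉
n≤⌈n/2⌉+⌈n/2⌉ n = subst (_≤ ⌈ n /2⌉ + ⌈ n /2⌉) (⌊n/2⌋+⌈n/2⌉≡n n) (+-monoˡ-≤ _ (⌊n/2⌋≤⌈n/2⌉ n))

⌊n/2⌋+⌊n/2⌋≤n : ∀ n → ⌊ n /2⌋ + ⌊ n /2⌋ ≤ n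
⌊n/2⌋+⌊n/2⌋≤n n = subst (⌊ n /2⌋ + ⌊ n /2⌋ ≤_) (⌊n/2⌋+⌈n/2⌉≡n n) (+-monoʳ-≤ _ (⌊n/2⌋≤⌈n/2⌉ n))

dyadicPoint-lower : ∀ d a b → a ≤ dyadicPoint d a b
dyadicPoint-lower zero    a b = ≤-refl
dyadicPoint-lower (suc d) a b with ⌈ a /2⌉ ≤? ⌊ b /2⌋
... | yes _ = ≤-trans (n≤⌈n/2⌉+⌈n/2⌉ a) (+-mono-≤ ih ih)
  where ih = dyadicPoint-lower d ⌈ a /2⌉ ⌊ b /2⌋
... | no  _ = ≤-refl

dyadicPoint-upper : ∀ d {a b} → a ≤ b → dyadicPoint d a b ≤ b
dyadicPoint-upper zero    a≤b = a≤b
dyadicPoint-upper (suc d) {a} {b} a≤b with ⌈ a /2⌉ ≤? ⌊ b /2⌋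
... | yes h = ≤-trans (+-mono-≤ ih ih) (⌊n/2⌋+⌊n/2⌋≤n b)
  where ih = dyadicPoint-upper d h
... | no  _ = a≤b

⌊log₂n⌋≤0⇒n≤1 : ∀ {n} → ⌊log₂ n ⌋ ≤ 0 → n ≤ 1
⌊log₂n⌋≤0⇒n≤1 {n} h with n ≤? 1
... | yes n≤1 = n≤1
... | no  n≰1 = contradiction (≤-trans (⌊log₂⌋-mono-≤ (≰⇒> n≰1)) h) λ ()

⌊log₂⌊n/2⌋⌋≤ : ∀ {d} n → ⌊log₂ n ⌋ ≤ suc d → ⌊log₂ ⌊ n /2⌋ ⌋ ≤ d
⌊log₂⌊n/2⌋⌋≤ n h = subst (_≤ _) (≡-sym (⌊log₂⌊n/2⌋⌋≡⌊log₂n⌋∸1 n)) (∸-monoˡ-≤ 1 h)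

-- The interval contains no even integer, hence is a single odd one. The form 2⌊b/2⌋ + 1 lets two
-- such integers be compared through their halves.
oddSingleton : ∀ {a b} → ¬ (⌈ a /2⌉ ≤ ⌊ b /2⌋) → a ≤ b → a ≡ ⌊ b /2⌋ + suc ⌊ b /2⌋
oddSingleton {zero}        {b}           h a≤b = contradiction z≤n h
oddSingleton {suc zero}    {suc zero}    h a≤b = refl
oddSingleton {suc zero}    {suc (suc b)} h a≤b = contradiction (s≤s z≤n) h
oddSingleton {suc (suc a)} {suc (suc b)} h (s≤s (s≤s a≤b)) =
  cong suc (trans (cong suc (oddSingleton (h ∘ s≤s) a≤b)) (≡-sym (+-suc ⌊ b /2⌋ (suc ⌊ b /2⌋))))

-- Intervals are only required to touch, i.e. to have no integer strictly between them,
-- because halving does not preserve intersection: [2,3] and [3,4] become [1,1] and [2,2].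
-- At the bottom of the recursion both intervals are odd singletons, and touching suffices.
dyadicPoint-unique : ∀ d {a b a′ b′} → 1 ≤ a → a ≤ b → 1 ≤ a′ → a′ ≤ b′ →
  ⌊log₂ b ⌋ ≤ d → ⌊log₂ b′ ⌋ ≤ d → a ≤ suc b′ → a′ ≤ suc b →
  dyadicLevel d a b ≡ dyadicLevel d a′ b′ → dyadicPoint d a b ≡ dyadicPoint d a′ b′
-- The depth bound and the lower bound 1 pin both intervals to [1, 1].
dyadicPoint-unique zero 1≤a a≤b 1≤a′ a′≤b′ lb lb′ _ _ _ = trans
  (≤-antisym (≤-trans a≤b (⌊log₂n⌋≤0⇒n≤1 lb)) 1≤a)
  (≤-antisym 1≤a′ (≤-trans a′≤b′ (⌊log₂n⌋≤0⇒n≤1 lb′)))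
dyadicPoint-unique (suc d) {a} {b} {a′} {b′} 1≤a a≤b 1≤a′ a′≤b′ lb lb′ t t′ eq
  with ⌈ a /2⌉ ≤? ⌊ b /2⌋ | ⌈ a′ /2⌉ ≤? ⌊ b′ /2⌋
-- `⌈ suc b′ /2⌉` computes to `suc ⌊ b′ /2⌋`, so halving preserves touching.
... | yes h | yes h′ = cong (λ k → k + k) (dyadicPoint-unique d (⌈n/2⌉-mono 1≤a) h (⌈n/2⌉-mono 1≤a′) h′
        (⌊log₂⌊n/2⌋⌋≤ b lb) (⌊log₂⌊n/2⌋⌋≤ b′ lb′) (⌈n/2⌉-mono t) (⌈n/2⌉-mono t′) (Fin.suc-injective eq))
... | no h  | no h′  = begin-equality
    a                             ≡⟨ oddSingleton h a≤b ⟩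
    ⌊ b /2⌋ + suc ⌊ b /2⌋         ≡⟨ cong (λ k → k + suc k) (≤-antisym (half-≤ {b} h t) (half-≤ {b′} h′ t′)) ⟩
    ⌊ b′ /2⌋ + suc ⌊ b′ /2⌋       ≡⟨ oddSingleton h′ a′≤b′ ⟨
    a′                            ∎
  where
  open ≤-Reasoning
  half-≤ : ∀ {b a b′} → ¬ (⌈ a /2⌉ ≤ ⌊ b /2⌋) → a ≤ suc b′ → ⌊ b /2⌋ ≤ ⌊ b′ /2⌋
  half-≤ h t = s≤s⁻¹ (≤-trans (≰⇒> h) (⌈n/2⌉-mono t))

-- Stabbing points of rational intervals

module _ {n} {P Q : Pred (Fin n) 0ℓ} (P? : Decidable P) (Q? : Decidable Q) (P⊆Q : P ⊆ Q) where

  length-filter-mono : ∀ xs → length (filter P? xs) ≤ length (filter Q? xs)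
  length-filter-mono []       = z≤n
  length-filter-mono (x ∷ xs) with P? x | Q? x
  ... | yes p | yes q = s≤s (length-filter-mono xs)
  ... | yes p | no ¬q = contradiction (P⊆Q p) ¬q
  ... | no ¬p | yes q = m≤n⇒m≤1+n (length-filter-mono xs)
  ... | no ¬p | no ¬q = length-filter-mono xs

  length-filter-strictMono : ∀ {xs z} → z ∈ xs → Q z → ¬ P z →
    length (filter P? xs) < length (filter Q? xs)
  length-filter-strictMono {x ∷ xs} (here refl) q ¬p with P? x | Q? x
  ... | yes p | _     = contradiction p ¬p
  ... | no _  | yes _ = s≤s (length-filter-mono xs)
  ... | no _  | no ¬q = contradiction q ¬q
  length-filter-strictMono {x ∷ xs} (there z∈) q ¬p with P? x | Q? x
  ... | yes p | yes _ = s≤s (length-filter-strictMono z∈ q ¬p)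
  ... | yes p | no ¬q = contradiction (P⊆Q p) ¬q
  ... | no _  | yes _ = m≤n⇒m≤1+n (length-filter-strictMono z∈ q ¬p)
  ... | no _  | no _  = length-filter-strictMono z∈ q ¬p

-- Ranks turn the rational intervals into integer intervals within [1, n] and keep overlaps, so
-- depth `⌊log₂ n ⌋` suffices.
module Stabbing {n} (lo hi : Fin n → ℚ) (lo≤hi : ∀ v → lo v ℚ.≤ hi v) where

  private
    -- 1 is added because 0 would be divisible by every power of two.
    rank : ℚ → ℕ
    rank t = suc (length (filter (λ u → hi u ℚ.<? t) (allFin n)))

    rank-mono : ∀ {s t} → s ℚ.≤ t → rank s ≤ rank t
    rank-mono s≤t = s≤s (length-filter-mono _ _ (λ h → ℚ.<-≤-trans h s≤t) (allFin n))

    rank-hi< : ∀ {v t} → hi v ℚ.< t → rank (hi v) < rank t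
    rank-hi< {v} hv<t = s≤s (length-filter-strictMono _ _ (λ h → ℚ.<-trans h hv<t)
      (∈-allFin v) hv<t (ℚ.<-irrefl refl))

    -- `hi v` is not below itself, so at most n - 1 endpoints are counted before the 1 is added.
    rank-hi≤n : ∀ v → rank (hi v) ≤ n
    rank-hi≤n v = subst (rank (hi v) ≤_) (length-tabulate (λ i → i))
      (filter-notAll _ (allFin n) (lose (∈-allFin v) (ℚ.<-irrefl refl)))

    -- Only serves as the value of min on the empty list.
    highEnd : ℚ
    highEnd = max ℚ.0ℚ (map hi (allFin n))

    -- A partial inverse of `rank`: the least right endpoint of rank at least q, when there is one.
    -- It depends on q alone, so equal indices give equal points.
    point : ℕ → ℚ
    point q = min highEnd (map hi (filter (λ w → q ≤? rank (hi w)) (allFin n)))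

    lo≤point : ∀ {v q} → rank (lo v) ≤ q → lo v ℚ.≤ point q
    lo≤point {v} {q} h = v≤min⁺
      (ℚ.≤-trans (lo≤hi v) (v≤max⁺ ℚ.0ℚ _ (inj₂ (lose (∈-map⁺ hi (∈-allFin v)) ℚ.≤-refl))))
      -- If `hi w` were below `lo v`, it would count towards `rank (lo v)`, giving
      -- `rank (hi w) < rank (lo v) ≤ q`.
      (All.map⁺ (All.map (λ q≤w → ℚ.≮⇒≥ λ w<v → <⇒≱ (rank-hi< w<v) (≤-trans h q≤w))
        (All.all-filter (λ w → q ≤? rank (hi w)) (allFin n))))

    point≤hi : ∀ {v q} → q ≤ rank (hi v) → point q ℚ.≤ hi v
    point≤hi {v} {q} h = min≤v⁺ highEnd _
      (inj₂ (lose (∈-map⁺ hi (∈-filter⁺ (λ w → q ≤? rank (hi w)) (∈-allFin v) h)) ℚ.≤-refl))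

    index : Fin n → ℕ
    index v = dyadicPoint ⌊log₂ n ⌋ (rank (lo v)) (rank (hi v))

  level : Fin n → Fin (suc ⌊log₂ n ⌋)
  level v = dyadicLevel ⌊log₂ n ⌋ (rank (lo v)) (rank (hi v))

  stab : Fin n → ℚ
  stab v = point (index v)

  lo≤stab : ∀ v → lo v ℚ.≤ stab v
  lo≤stab v = lo≤point (dyadicPoint-lower ⌊log₂ n ⌋ (rank (lo v)) (rank (hi v)))

  stab≤hi : ∀ v → stab v ℚ.≤ hi v
  stab≤hi v = point≤hi (dyadicPoint-upper ⌊log₂ n ⌋ (rank-mono (lo≤hi v)))

  stab-unique : ∀ u v → level u ≡ level v → lo u ℚ.≤ hi v → lo v ℚ.≤ hi u → stab u ≡ stab v
  stab-unique u v eq lu≤hv lv≤hu = cong point (dyadicPoint-unique ⌊log₂ n ⌋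
    (s≤s z≤n) (rank-mono (lo≤hi u)) (s≤s z≤n) (rank-mono (lo≤hi v))
    (⌊log₂⌋-mono-≤ (rank-hi≤n u)) (⌊log₂⌋-mono-≤ (rank-hi≤n v))
    (m≤n⇒m≤1+n (rank-mono lu≤hv)) (m≤n⇒m≤1+n (rank-mono lv≤hu)) eq)

-- The colouring

module _ {m K : ℕ} where

  combine₄ : Fin m → Fin m → Fin m → Fin K → Fin (m * (m * (m * K)))
  combine₄ a b c d = combine a (combine b (combine c d))

  combine₄-injective : ∀ a b c d a′ b′ c′ d′ → combine₄ a b c d ≡ combine₄ a′ b′ c′ d′ →
    a ≡ a′ × b ≡ b′ × c ≡ c′ × d ≡ d′
  combine₄-injective a b c d a′ b′ c′ d′ eq =
    let a≡a′ , eq₁ = Fin.combine-injective a (combine b (combine c d)) a′ (combine b′ (combine c′ d′)) eq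
        b≡b′ , eq₂ = Fin.combine-injective b (combine c d) b′ (combine c′ d′) eq₁
        c≡c′ , d≡d′ = Fin.combine-injective c d c′ d′ eq₂
    in a≡a′ , b≡b′ , c≡c′ , d≡d′

module DiskColoring {n K} (D : Fin n → Disk) (pack : Code → Fin K)
                    (pack-injective : ∀ c c′ → pack c ≡ pack c′ → c ≡ c′) where

  open DiskGeometry

  private
    L : ℕ
    L = ⌊log₂ n ⌋

    left≤right : ∀ a v → a ℚ.- r (D v) ℚ.≤ a ℚ.+ r (D v)
    left≤right a v = ℚ.+-monoʳ-≤ a (ℚ.≤-trans (ℚ.neg-antimono-≤ (r≥0 (D v))) (r≥0 (D v)))

    module X = Stabbing (λ v → x (D v) ℚ.- r (D v)) (λ v → x (D v) ℚ.+ r (D v)) (λ v → left≤right (x (D v)) v)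
    module Y = Stabbing (λ v → y (D v) ℚ.- r (D v)) (λ v → y (D v) ℚ.+ r (D v)) (λ v → left≤right (y (D v)) v)

    centred : Fin n → Disk
    centred v = shift (X.stab v) (Y.stab v) (D v)

    centred-meetsAxes : ∀ v → MeetsAxes (centred v)
    centred-meetsAxes v = meetsAxes-shift (D v) (X.lo≤stab v) (X.stab≤hi v) (Y.lo≤stab v) (Y.stab≤hi v)

    module R = Stabbing (λ v → gap (centred v)) (λ v → r (D v)) (λ v → gap≤r (centred-meetsAxes v))

    anchored : ∀ v → Anchored (R.stab v) (centred v)
    anchored v = record { meetsAxes = centred-meetsAxes v ; gap≤τ = R.lo≤stab v ; τ≤r = R.stab≤hi v }

    codeOf : Fin n → Code
    codeOf v = code (R.stab v) (centred v)

  color : Fin n → Fin (suc L * (suc L * (suc L * K)))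
  color v = combine₄ {suc L} {K} (X.level v) (Y.level v) (R.level v) (pack (codeOf v))

  private
    color-injective : ∀ u v → color u ≡ color v →
      X.level u ≡ X.level v × Y.level u ≡ Y.level v × R.level u ≡ R.level v × pack (codeOf u) ≡ pack (codeOf v)
    color-injective u v = combine₄-injective {suc L} {K}
      (X.level u) (Y.level u) (R.level u) (pack (codeOf u))
      (X.level v) (Y.level v) (R.level v) (pack (codeOf v))

    -- Within a colour class, intersection coincides with this equivalence relation, whose classes
    -- are therefore cliques.
    SameStab : (u v : Fin n) → Set
    SameStab u v = X.stab u ≡ X.stab v × Y.stab u ≡ Y.stab v × R.stab u ≡ R.stab v

    intersect⇒sameStab : ∀ u v → color u ≡ color v → Intersect (D u) (D v) → SameStab u v
    intersect⇒sameStab u v c h = s , t , τ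
      where
      levels = color-injective u v c
      h′ : Intersect (D v) (D u)
      h′ = Intersect-sym (D u) (D v) h
      s : X.stab u ≡ X.stab v
      s = X.stab-unique u v (proj₁ levels)
        (intersect⇒x-overlap (D u) (D v) h) (intersect⇒x-overlap (D v) (D u) h′)
      t : Y.stab u ≡ Y.stab v
      t = Y.stab-unique u v (proj₁ (proj₂ levels))
        (intersect⇒y-overlap (D u) (D v) h) (intersect⇒y-overlap (D v) (D u) h′)
      -- Gaps can be compared only in common coordinates, so `s` and `t` come first.
      τ : R.stab u ≡ R.stab v
      τ = R.stab-unique u v (proj₁ (proj₂ (proj₂ levels)))
        (shift-gap≤r (D v) (D u) (≡-sym s) (≡-sym t) (centred-meetsAxes v) (centred-meetsAxes u) h′)
        (shift-gap≤r (D u) (D v) s t (centred-meetsAxes u) (centred-meetsAxes v) h)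

    sameStab⇒intersect : ∀ u v → color u ≡ color v → SameStab u v → Intersect (D u) (D v)
    sameStab⇒intersect u v c (s , t , τ) = shift-anchored⇒intersect (D u) (D v) s t τ (anchored u) (anchored v)
      (pack-injective (codeOf u) (codeOf v) (proj₂ (proj₂ (proj₂ (color-injective u v c)))))

    sameStab-trans : ∀ u v w → SameStab u v → SameStab v w → SameStab u w
    sameStab-trans u v w (s , t , τ) (s′ , t′ , τ′) = trans s s′ , trans t t′ , trans τ τ′

  color-transitive : ∀ u v w → color u ≡ color v → color v ≡ color w →
    Intersect (D u) (D v) → Intersect (D v) (D w) → Intersect (D u) (D w)
  color-transitive u v w uv vw huv hvw = sameStab⇒intersect u w (trans uv vw)
    (sameStab-trans u v w (intersect⇒sameStab u v uv huv) (intersect⇒sameStab v w vw hvw))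

-- Number of colours

colors-bound : ∀ {L} K → 1 ≤ L → suc L * (suc L * (suc L * K)) ≤ 8 * K * L ^ 3
colors-bound {L} K 1≤L = begin
  suc L * (suc L * (suc L * K))        ≤⟨ *-mono-≤ S≤ (*-mono-≤ S≤ (*-monoˡ-≤ K S≤)) ⟩
  (L + L) * ((L + L) * ((L + L) * K))  ≡⟨ solve 2 (λ L K → (L :+ L) :* ((L :+ L) :* ((L :+ L) :* K))
                                            := con 8 :* K :* (L :* (L :* (L :* con 1)))) refl L K ⟩
  8 * K * L ^ 3                        ∎
  where
  open ≤-Reasoning
  open +-*-Solver
  -- L ≥ 1 follows from n ≥ 2; doubling for each of the three levels costs the factor 8.
  S≤ : suc L ≤ L + L
  S≤ = +-monoˡ-≤ L 1≤L

diskGraph-subchromatic : ∀ {K} (pack : Code → Fin K) → (∀ c c′ → pack c ≡ pack c′ → c ≡ c′) →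
  ∀ n → 2 ≤ n → (G : Graph n) → IsDiskGraph G → SubchromaticAtMost G (8 * K * ⌊log₂ n ⌋ ^ 3)
diskGraph-subchromatic {K} pack pack-injective n 2≤n G (D , adj) =
  (λ v → inject≤ (color v) bound) , λ u v w uv vw u≢w auv avw → Equivalence.from (adj u w)
    (u≢w , color-transitive u v w (same u v uv) (same v w vw) (meet u v auv) (meet v w avw))
  where
  open DiskColoring D pack pack-injective
  bound : suc ⌊log₂ n ⌋ * (suc ⌊log₂ n ⌋ * (suc ⌊log₂ n ⌋ * K)) ≤ 8 * K * ⌊log₂ n ⌋ ^ 3
  bound = colors-bound K (⌊log₂⌋-mono-≤ 2≤n)
  same : ∀ u v → inject≤ (color u) bound ≡ inject≤ (color v) bound → color u ≡ color v
  same u v = Fin.inject≤-injective bound bound (color u) (color v)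
  meet : ∀ u v → Adj G u v → Intersect (D u) (D v)
  meet u v a = proj₂ (Equivalence.to (adj u v) a)

-- 1568 = 2³ · 14².
pack : Code → Fin 1568
pack (a , b , c , d , e) = combine a (combine b (combine c (combine d e)))

pack-injective : ∀ c c′ → pack c ≡ pack c′ → c ≡ c′
pack-injective (a , b , c , d , e) (a′ , b′ , c′ , d′ , e′) eq
  with refl , eq₁ ← Fin.combine-injective a (combine b (combine c (combine d e))) a′ (combine b′ (combine c′ (combine d′ e′))) eq
  with refl , eq₂ ← Fin.combine-injective b (combine c (combine d e)) b′ (combine c′ (combine d′ e′)) eq₁
  with refl , eq₃ ← Fin.combine-injective c (combine d e) c′ (combine d′ e′) eq₂
  with refl , refl ← Fin.combine-injective d e d′ e′ eq₃ = refl

theorem2 : Σ ℕ λ C → ∀ (n : ℕ) → 2 ≤ n → (G : Graph n) → IsDiskGraph G →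
    SubchromaticAtMost G (C * ⌊log₂ n ⌋ ^ 3)
theorem2 = 8 * 1568 , diskGraph-subchromatic pack pack-injective
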